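{- The quantity $\zeta(n) = \max\{ \mathsf{zn}(S[i..]) / \mathsf{zn}(S) \mid S \in \Sigma^n,\ 1 < i \leq n\}$ is asymptotically lower bounded by $4/3$, that is, $\liminf_{n\to\infty}\zeta(n)\ge 4/3$. Here the alphabet $\Sigma$ is not bounded in size (it may grow with $n$).
   Context: Strings are indexed from $1$; $S[i..j]$ is the substring from position $i$ to $j$ (empty if $j<i$), and $S[i..]=S[i..|S|]$. $\mathsf{lcp}(X,Y)$ is the length of the longest common prefix of $X$ and $Y$. Non self-referencing LZ77 factorization: $\mathsf{LZN}(S)$ is the factorization $S=f_1\cdots f_{z}$ defined greedily from left to right as follows. Let $u_i=|f_1\cdots f_{i-1}|+1$ and let $p_i=\max_{1\le j<u_i}\mathsf{lcp}(S[u_i..],S[j..u_i-1])$ (with $p_i=0$ if $i=1$). Then $f_i=S[u_i..\min\{u_i+p_i,|S|\}]$. That is, $f_i$ is a fresh letter or the shortest prefix of $S[u_i..]$ with no occurrence inside $S[1..u_i-1]$ (or all of $S[u_i..]$ if that occurs in $S[1..u_i-1]$). The size $\mathsf{zn}(S)$ is the number $z$ of factors. -}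

module Defs where

open import Data.Nat.Base as ℕ using (ℕ; zero; suc; _∸_; _≤_; _<_; z≤n; s≤s; z<s; s<s)
import Data.Nat.Properties as ℕ
open import Data.Integer.Base using (+_)
open import Data.Rational.Base as ℚ using (ℚ; 0ℚ; _/_)
import Data.Rational.Properties as ℚ
open import Data.List.Base
  using (List; []; _∷_; _++_; length; map; take; drop; tails; concat; foldr; upTo; cartesianProductWith)
open import Data.List.Properties
  using (take++drop≡id; map-++; take-map; drop-map; length-map; length-upTo)
import Data.List.Extrema
open import Data.List.Relation.Unary.All as All using (All; []; _∷_)
import Data.List.Relation.Unary.All.Properties as All
open import Data.List.Relation.Unary.Any using (here; there)
open import Data.List.Membership.Propositional using (_∈_)
open import Data.List.Membership.Propositional.Properties
  using (∈-map⁺; ∈-map⁻; ∈-upTo⁺; ∈-upTo⁻; ∈-cartesianProductWith⁺; ∈-cartesianProductWith⁻)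
open import Data.Product.Base using (_×_; _,_; proj₁; proj₂; ∃-syntax)
open import Data.Sum.Base using ([_,_]′)
open import Function.Base using (_∘_)
open import Relation.Binary.Bundles using (DecTotalOrder)
open import Relation.Nullary using (yes; no; contradiction)
open import Level using (0ℓ)
open import Relation.Unary using (Pred)
open import Relation.Binary.PropositionalEquality
  using (_≡_; refl; sym; trans; cong; cong₂; subst)

-- The alphabet is unbounded: letters are arbitrary natural numbers, and only
-- equality between letters is ever used.
Word : Set
Word = List ℕ

-- S [ i ‥] is the suffix starting at the 1-based position i.
_[_‥] : Word → ℕ → Word
S [ i ‥] = drop (i ∸ 1) S

lcp : Word → Word → ℕ
lcp (x ∷ xs) (y ∷ ys) with x ℕ.≟ y
... | yes _ = suc (lcp xs ys)
... | no  _ = 0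
lcp _ _ = 0

-- With past = S[1..u-1] and rest = S[u..], the maximum over 1 ≤ j < u of
-- lcp(S[u..], S[j..u-1]): the words S[j..u-1] are the nonempty tails of past.
-- The empty tail contributes 0, which is also the prescribed value for u = 1.
longestPrevious : (past rest : Word) → ℕ
longestPrevious past rest = foldr ℕ._⊔_ 0 (map (lcp rest) (tails past))

-- The factors of rest, given that past precedes it. The first argument is fuel,
-- length rest being enough since every factor is nonempty (see concat-LZN).
-- take and drop truncate at the end of the word, which is the min with |S|.
factorsFrom : ℕ → (past rest : Word) → List Word
factorsFrom zero    past rest          = []
factorsFrom (suc k) past []            = []
factorsFrom (suc k) past rest@(_ ∷ _) = take ℓ rest ∷ factorsFrom k (past ++ take ℓ rest) (drop ℓ rest)
  where ℓ = suc (longestPrevious past rest)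

LZN : Word → List Word
LZN S = factorsFrom (length S) [] S

zn : Word → ℕ
zn S = length (LZN S)

-- The clause for the empty word only serves totality.
ratio : Word → ℕ → ℚ
ratio []          i = 0ℚ
ratio S@(_ ∷ _) i = + zn (S [ i ‥]) / zn S

Quotient : ℕ → Pred ℚ 0ℓ
Quotient n q = ∃[ S ] ∃[ i ] (length S ≡ n × 1 < i × i ≤ n × q ≡ ratio S i)

IsMaximum : Pred ℚ 0ℓ → Pred ℚ 0ℓ
IsMaximum P m = P m × (∀ q → P q → q ℚ.≤ m)

-- c ≤ liminf a: since liminf a is in general a real number or ±∞, this is
-- spelled out as "for every ε > 0, eventually c - ε ≤ aₙ".
_≤liminf_ : ℚ → (ℕ → ℚ) → Set
c ≤liminf a = ∀ ε → 0ℚ ℚ.< ε → ∃[ N ] (∀ n → N ≤ n → c ℚ.- ε ℚ.≤ a n)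

private
  length-drop-≤ : ∀ {k} p (xs : Word) → length xs ≤ k → length (drop p xs) ≤ k
  length-drop-≤ zero    xs       le = le
  length-drop-≤ (suc p) []       le = le
  length-drop-≤ (suc p) (x ∷ xs) le = length-drop-≤ p xs (ℕ.≤-trans (ℕ.n≤1+n _) le)

concat-factorsFrom : ∀ k past rest → length rest ≤ k → concat (factorsFrom k past rest) ≡ rest
concat-factorsFrom zero    past []            le       = refl
concat-factorsFrom (suc k) past []            le       = refl
concat-factorsFrom (suc k) past rest@(x ∷ xs) (s≤s le) =
  trans (cong (take (suc p) rest ++_) (concat-factorsFrom k _ (drop p xs) (length-drop-≤ p xs le)))
        (take++drop≡id (suc p) rest)
  where p = longestPrevious past rest

concat-LZN : ∀ S → concat (LZN S) ≡ S
concat-LZN S = concat-factorsFrom (length S) [] S ℕ.≤-refl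

module Renaming (f : ℕ → ℕ) (P : Pred ℕ 0ℓ)
                (f-inj : ∀ {x y} → P x → P y → f x ≡ f y → x ≡ y) where

  lcp-map : ∀ {xs ys} → All P xs → All P ys → lcp (map f xs) (map f ys) ≡ lcp xs ys
  lcp-map []        _  = refl
  lcp-map (_ ∷ _)   [] = refl
  lcp-map {x ∷ _} {y ∷ _} (px ∷ pxs) (py ∷ pys) with x ℕ.≟ y | f x ℕ.≟ f y
  ... | yes _    | yes _     = cong suc (lcp-map pxs pys)
  ... | yes x≡y  | no fx≢fy  = contradiction (cong f x≡y) fx≢fy
  ... | no x≢y   | yes fx≡fy = contradiction (f-inj px py fx≡fy) x≢y
  ... | no _     | no _      = refl

  lcps-map : ∀ {past rest} → All P past → All P rest →
             map (lcp (map f rest)) (tails (map f past)) ≡ map (lcp rest) (tails past)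
  lcps-map []               pr = cong (_∷ []) (lcp-map pr [])
  lcps-map pp@(_ ∷ pp′) pr = cong₂ _∷_ (lcp-map pr pp) (lcps-map pp′ pr)

  longestPrevious-map : ∀ {past rest} → All P past → All P rest →
                        longestPrevious (map f past) (map f rest) ≡ longestPrevious past rest
  longestPrevious-map pp pr = cong (foldr ℕ._⊔_ 0) (lcps-map pp pr)

  factorsFrom-map : ∀ k {past rest} → All P past → All P rest →
                    factorsFrom k (map f past) (map f rest) ≡ map (map f) (factorsFrom k past rest)
  factorsFrom-map zero    pp pr = refl
  factorsFrom-map (suc k) pp [] = refl
  factorsFrom-map (suc k) {past} {rest@(x ∷ xs)} pp pr@(_ ∷ _)
    rewrite longestPrevious-map pp pr
          | take-map {f = f} (longestPrevious past rest) xs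
          | drop-map {f = f} (longestPrevious past rest) xs
          | sym (map-++ f past (take (suc (longestPrevious past rest)) rest))
    = cong (_ ∷_) (factorsFrom-map k (All.++⁺ pp (All.take⁺ _ pr)) (All.drop⁺ (suc (longestPrevious past rest)) pr))

  zn-map : ∀ {S} → All P S → zn (map f S) ≡ zn S
  zn-map {S} pS rewrite length-map f S | factorsFrom-map (length S) [] pS = length-map (map f) (LZN S)

  private
    cong-/ : ∀ {a b c d} .{{_ : ℕ.NonZero c}} .{{_ : ℕ.NonZero d}} → a ≡ b → c ≡ d → + a / c ≡ + b / d
    cong-/ refl refl = refl

  ratio-map : ∀ {S} i → All P S → ratio (map f S) i ≡ ratio S i
  ratio-map         i []           = refl
  ratio-map {S} i pS@(_ ∷ _) = cong-/
    (trans (cong zn (drop-map (i ∸ 1) S)) (zn-map (All.drop⁺ (i ∸ 1) pS)))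
    (zn-map pS)

-- The position (from 0) of the first occurrence of a letter; it renames a word
-- of length n to one over the letters 0, …, n - 1.
firstIndex : Word → ℕ → ℕ
firstIndex []       x = 0
firstIndex (y ∷ ys) x with x ℕ.≟ y
... | yes _ = 0
... | no  _ = suc (firstIndex ys x)

firstIndex-< : ∀ S {x} → x ∈ S → firstIndex S x < length S
firstIndex-< (y ∷ ys) {x} x∈S with x ℕ.≟ y | x∈S
... | yes _   | _         = z<s
... | no x≢y  | here x≡y  = contradiction x≡y x≢y
... | no _    | there x∈S = s<s (firstIndex-< ys x∈S)

firstIndex-injective : ∀ S {x y} → x ∈ S → y ∈ S → firstIndex S x ≡ firstIndex S y → x ≡ y
firstIndex-injective (z ∷ zs) {x} {y} x∈S y∈S eq with x ℕ.≟ z | y ℕ.≟ z | x∈S | y∈S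
... | yes x≡z | yes y≡z | _        | _        = trans x≡z (sym y≡z)
... | no x≢z  | _       | here x≡z | _        = contradiction x≡z x≢z
... | no _    | no y≢z  | _        | here y≡z = contradiction y≡z y≢z
... | no _    | no _    | there p  | there q  = firstIndex-injective zs p q (ℕ.suc-injective eq)

private
  module Extremaℚ = Data.List.Extrema (DecTotalOrder.totalOrder ℚ.≤-decTotalOrder)

wordsOver : Word → ℕ → List Word
wordsOver Σ zero    = [] ∷ []
wordsOver Σ (suc n) = cartesianProductWith _∷_ Σ (wordsOver Σ n)

∈-wordsOver⁺ : ∀ {Σ S} → All (_∈ Σ) S → S ∈ wordsOver Σ (length S)
∈-wordsOver⁺ []         = here refl
∈-wordsOver⁺ (px ∷ pxs) = ∈-cartesianProductWith⁺ _∷_ px (∈-wordsOver⁺ pxs)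

∈-wordsOver⁻ : ∀ Σ n {S} → S ∈ wordsOver Σ n → length S ≡ n
∈-wordsOver⁻ Σ zero    (here refl) = refl
∈-wordsOver⁻ Σ (suc n) S∈
  with _ , _ , _ , T∈ , refl ← ∈-cartesianProductWith⁻ _∷_ Σ (wordsOver Σ n) S∈
  = cong suc (∈-wordsOver⁻ Σ n T∈)

private
  candidates : ℕ → List ℚ
  candidates n = cartesianProductWith ratio (wordsOver (upTo n) n) (map (2 ℕ.+_) (upTo (n ∸ 1)))

  candidates-sound : ∀ n {q} → q ∈ candidates (suc n) → Quotient (suc n) q
  candidates-sound n q∈
    with S , i , S∈ , i∈ , q≡ ← ∈-cartesianProductWith⁻ ratio (wordsOver (upTo (suc n)) (suc n)) _ q∈
    with j , j∈ , refl ← ∈-map⁻ (2 ℕ.+_) i∈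
    = S , i , ∈-wordsOver⁻ _ (suc n) S∈ , s≤s (s≤s z≤n) , s≤s (∈-upTo⁻ j∈) , q≡

  candidates-complete : ∀ {n q} → Quotient n q → q ∈ candidates n
  candidates-complete (S@(_ ∷ _) , suc (suc j) , refl , _ , s≤s j<n , refl) =
    subst (_∈ candidates (length S)) (ratio-map (suc (suc j)) S⊆S)
      (∈-cartesianProductWith⁺ ratio S′∈ (∈-map⁺ (2 ℕ.+_) (∈-upTo⁺ (j<n))))
    where
    open Renaming (firstIndex S) (_∈ S) (firstIndex-injective S)
    S⊆S : All (_∈ S) S
    S⊆S = All.tabulate (λ x∈S → x∈S)
    S′∈ : map (firstIndex S) S ∈ wordsOver (upTo (length S)) (length S)
    S′∈ = subst (λ n → map (firstIndex S) S ∈ wordsOver (upTo (length S)) n) (length-map (firstIndex S) S)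
            (∈-wordsOver⁺ (All.map⁺ (All.map (∈-upTo⁺ ∘ firstIndex-< S) S⊆S)))
  candidates-complete ([] , suc (suc _) , refl , _ , () , _)
  candidates-complete (_ , zero , _ , () , _)
  candidates-complete (_ , suc zero , _ , s≤s () , _)

  greatest : ∀ q qs → ∃[ m ] (m ∈ q ∷ qs × All (ℚ._≤ m) qs)
  greatest q qs = Extremaℚ.max q qs
                , [ here , there ]′ (Extremaℚ.argmax-sel (λ p → p) q qs)
                , Extremaℚ.xs≤max q qs

-- There are infinitely many words of length n, but up to a renaming of letters,
-- which preserves ratios, each of them is a word over 0, …, n - 1.
maximum-exists : ∀ n → 2 ≤ n → ∃[ m ] IsMaximum (Quotient n) m
maximum-exists n@(suc n′) 2≤n = from-greatest (greatest (ratio (upTo n) 2) (candidates n))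
  where
  attained : ∀ {m} → m ∈ ratio (upTo n) 2 ∷ candidates n → Quotient n m
  attained (here m≡q) = upTo n , 2 , length-upTo n , s≤s (s≤s z≤n) , 2≤n , m≡q
  attained (there m∈) = candidates-sound n′ m∈
  from-greatest : ∃[ m ] (m ∈ ratio (upTo n) 2 ∷ candidates n × All (ℚ._≤ m) (candidates n)) →
                  ∃[ m ] IsMaximum (Quotient n) m
  from-greatest (m , m∈ , ≤m) = m , attained m∈ , λ _ → All.lookup ≤m ∘ candidates-complete

-- ζ n is meaningful for n ≥ 2 only: there is no i with 1 < i ≤ n otherwise.
ζ : ℕ → ℚ
ζ (suc (suc n)) = proj₁ (maximum-exists (suc (suc n)) (s≤s (s≤s z≤n)))
ζ _             = 0ℚ

ζ-isMaximum : ∀ n → 2 ≤ n → IsMaximum (Quotient n) (ζ n)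
ζ-isMaximum (suc (suc n)) (s≤s (s≤s z≤n)) = proj₂ (maximum-exists (suc (suc n)) (s≤s (s≤s z≤n)))

{-# OPTIONS --safe #-}
-- For letters x₁, …, x₂ₖ and separators $₀, …, $ₖ, all distinct, put
-- S = x₁⋯x₂ₖ $₀ B₁⋯Bₖ with Bⱼ = x₁⋯x₂ⱼ $ⱼ. In S every Bⱼ is a single factor, since
-- x₁⋯x₂ⱼ is a prefix of S. Once the first letter of S is deleted, the longest
-- prefix of Bⱼ seen before is x₁⋯x₂ⱼ₋₂, inside Bⱼ₋₁, so Bⱼ splits into the factors
-- x₁⋯x₂ⱼ₋₁ and x₂ⱼ $ⱼ. The counts are 3k + 1 and 4k. Appending a prefix of S adds at
-- most one factor to S and reaches every length between two consecutive values of |S|.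
module Submission where

open import Defs
open import Data.Integer.Base using (+_; +[1+_]; +≤+)
import Data.Integer.Base as ℤ
import Data.Integer.Properties as ℤ
open import Data.Rational.Base using (ℚ; mkℚ; _/_; 0ℚ; *<*)
import Data.Rational.Base as ℚ
import Data.Rational.Properties as ℚ
import Data.Rational.Unnormalised.Base as ℚᵘ
import Data.Rational.Unnormalised.Properties as ℚᵘ
open import Data.Nat.Base hiding (_/_)
open import Data.Nat.Properties
open import Data.Nat.Tactic.RingSolver using (solve-∀)
open import Data.List.Base using ([]; _∷_; [_]; _++_; _∷ʳ_; length; take; drop)
open import Data.List.Properties
  using (++-assoc; ++-identityʳ; length-++; length-++-≤ʳ; length-take; drop-all; take++drop≡id)
open import Data.List.Relation.Unary.All as All using (All; []; _∷_)
import Data.List.Relation.Unary.All.Properties as All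
open import Data.List.Relation.Unary.Any using (here; there)
open import Data.List.Membership.Propositional using (_∈_; _∉_)
open import Data.List.Membership.Propositional.Properties using (∈-++⁺ˡ)
import Data.List.Relation.Binary.Prefix.Heterogeneous as Prefix
open Prefix using ([]; _∷_)
import Data.List.Relation.Binary.Infix.Heterogeneous as Infix
open Infix using (here; there; _++ⁱ_; _ⁱ++_)
import Data.List.Relation.Binary.Infix.Heterogeneous.Properties as Infix
open import Data.Product.Base using (_×_; _,_; proj₂; ∃-syntax)
open import Data.Sum.Base using (_⊎_; inj₁; inj₂; map₁)
open import Function.Base using (_∘_)
open import Relation.Nullary using (¬_; yes; no; contradiction)
open import Relation.Binary.PropositionalEquality
  using (_≡_; refl; sym; trans; cong; cong₂; subst; module ≡-Reasoning)

private
  variable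
    m n : ℕ
    past rest A B v w : Word

-- Prefixes and occurrences of words.

_IsPrefixOf_ _OccursIn_ : Word → Word → Set
_IsPrefixOf_ = Prefix.Prefix _≡_
_OccursIn_   = Infix.Infix _≡_

prefix-refl : w IsPrefixOf w
prefix-refl {[]}    = []
prefix-refl {x ∷ w} = refl ∷ prefix-refl

prefix-++ : ∀ w c → w IsPrefixOf (w ++ c)
prefix-++ []      c = []
prefix-++ (x ∷ w) c = refl ∷ prefix-++ w c

occurs-singleton : ∀ {x} → x ∈ w → [ x ] OccursIn w
occurs-singleton (here refl) = here (refl ∷ [])
occurs-singleton (there x∈w) = there (occurs-singleton x∈w)

occurs-∈ : ∀ {x} → v OccursIn w → x ∈ v → x ∈ w
occurs-∈ (here p)  = go p
  where
  go : ∀ {v w x} → v IsPrefixOf w → x ∈ v → x ∈ w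
  go (refl ∷ p) (here x≡)   = here x≡
  go (refl ∷ p) (there x∈v) = there (go p x∈v)
occurs-∈ (there o) = there ∘ occurs-∈ o

last-∉ : ∀ w {y} → y ∉ past → ¬ ((w ∷ʳ y) OccursIn past)
last-∉ w y∉ o = y∉ (occurs-∈ o (∈-last w))
  where
  ∈-last : ∀ w {y} → y ∈ w ∷ʳ y
  ∈-last []      = here refl
  ∈-last (x ∷ w) = there (∈-last w)

prefix-separator : ∀ {s} p {q} → s ∉ v → v IsPrefixOf (p ++ s ∷ q) → v IsPrefixOf p
prefix-separator []      s∉v []         = []
prefix-separator (x ∷ p) s∉v []         = []
prefix-separator []      s∉v (refl ∷ _) = contradiction (here refl) s∉v
prefix-separator (x ∷ p) s∉v (eq ∷ pre) = eq ∷ prefix-separator p (s∉v ∘ there) pre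

-- An occurrence that meets the letter `s` would put `s` into `v`, so none can straddle it.
occurs-separator : ∀ {s} p {q} → s ∉ v → v OccursIn (p ++ s ∷ q) → v OccursIn p ⊎ v OccursIn q
occurs-separator []      s∉v (here pre) = inj₁ (here (prefix-separator [] s∉v pre))
occurs-separator (x ∷ p) s∉v (here pre) = inj₁ (here (prefix-separator (x ∷ p) s∉v pre))
occurs-separator []      s∉v (there o)  = inj₂ o
occurs-separator (x ∷ p) s∉v (there o)  = map₁ there (occurs-separator p s∉v o)

-- Bounds on the longest previous match.

lcp-≥ : w IsPrefixOf rest → w IsPrefixOf v → length w ≤ lcp rest v
lcp-≥ []               _                = z≤n
lcp-≥ (refl ∷ p) (_∷_ {b = y} refl q) with y ≟ y
... | yes _   = s≤s (lcp-≥ p q)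
... | no  y≢y = contradiction refl y≢y

lcp-≤ : ∀ w {y c} v → ¬ ((w ∷ʳ y) IsPrefixOf v) → lcp (w ++ y ∷ c) v ≤ length w
lcp-≤ []          []      _ = z≤n
lcp-≤ (x ∷ w)     []      _ = z≤n
lcp-≤ []      {y} (z ∷ v) ¬p with y ≟ z
... | yes y≡z = contradiction (y≡z ∷ []) ¬p
... | no  _   = z≤n
lcp-≤ (x ∷ w)     (z ∷ v) ¬p with x ≟ z
... | yes x≡z = s≤s (lcp-≤ w v (¬p ∘ (x≡z ∷_)))
... | no  _   = z≤n

longestPrevious-≥ : w IsPrefixOf rest → w OccursIn past → length w ≤ longestPrevious past rest
longestPrevious-≥ {past = []}    p (here q)  = ≤-trans (lcp-≥ p q) (m≤m⊔n _ _)
longestPrevious-≥ {past = _ ∷ _} p (here q)  = ≤-trans (lcp-≥ p q) (m≤m⊔n _ _)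
longestPrevious-≥ {rest = rest} {past = x ∷ past} p (there o) =
  ≤-trans (longestPrevious-≥ p o) (m≤n⊔m (lcp rest (x ∷ past)) _)

-- The maximum runs over the tails of `past`, and a match longer than `w` with one of them would be
-- an occurrence of `w ∷ʳ y`.
longestPrevious-≤ : ∀ w {y c} past → ¬ ((w ∷ʳ y) OccursIn past) →
                    longestPrevious past (w ++ y ∷ c) ≤ length w
longestPrevious-≤ w []         ¬o = ⊔-lub (lcp-≤ w [] (¬o ∘ here)) z≤n
longestPrevious-≤ w (x ∷ past) ¬o =
  ⊔-lub (lcp-≤ w (x ∷ past) (¬o ∘ here)) (longestPrevious-≤ w past (¬o ∘ there))

-- Greedy steps and factorizations into complete factors.

take-∷ʳ-++ : ∀ w {y} (c : Word) → take (suc (length w)) (w ++ y ∷ c) ≡ w ∷ʳ y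
take-∷ʳ-++ []      c = refl
take-∷ʳ-++ (x ∷ w) c = cong (x ∷_) (take-∷ʳ-++ w c)

drop-∷ʳ-++ : ∀ w {y} (c : Word) → drop (suc (length w)) (w ++ y ∷ c) ≡ c
drop-∷ʳ-++ []      c = refl
drop-∷ʳ-++ (x ∷ w) c = drop-∷ʳ-++ w c

factorsFrom-factor : ∀ k past w {y} c → longestPrevious past (w ++ y ∷ c) ≡ length w →
  factorsFrom (suc k) past (w ++ y ∷ c) ≡ (w ∷ʳ y) ∷ factorsFrom k (past ++ w ∷ʳ y) c
factorsFrom-factor k past []          c eq rewrite eq = refl
factorsFrom-factor k past (x ∷ w) {y} c eq
  rewrite eq | take-∷ʳ-++ w {y} c | drop-∷ʳ-++ w {y} c = refl

-- The longest previous match already covers all of `rest`, so a first factor exhausts it.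
factorsFrom-previous : ∀ k → rest OccursIn past → length (factorsFrom k past rest) ≤ 1
factorsFrom-previous zero o = z≤n
factorsFrom-previous {[]} (suc k) o = z≤n
factorsFrom-previous {rest@(x ∷ xs)} {past} (suc k) o =
  s≤s (≤-reflexive (nothing-left k (drop-all _ xs (<⇒≤ (longestPrevious-≥ prefix-refl o)))))
  where
  nothing-left : ∀ k {past rest} → rest ≡ [] → length (factorsFrom k past rest) ≡ 0
  nothing-left zero    refl = refl
  nothing-left (suc k) refl = refl

-- All factors are complete here, i.e. end with a letter that makes them new; hence
-- the factorization does not depend on what follows A.
data Factorization : (past A : Word) → ℕ → Set where
  []     : Factorization past [] 0
  factor : ∀ w {y} → w OccursIn past → ¬ ((w ∷ʳ y) OccursIn past) →
           Factorization (past ++ w ∷ʳ y) A m → Factorization past (w ∷ʳ y ++ A) (suc m)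

single : ∀ w {y} → w OccursIn past → ¬ ((w ∷ʳ y) OccursIn past) → Factorization past (w ∷ʳ y) 1
single {past} w {y} o ¬o =
  subst (λ A → Factorization past A 1) (++-identityʳ (w ∷ʳ y)) (factor w o ¬o [])

Factorization-++ : Factorization past A m → Factorization (past ++ A) B n →
                   Factorization past (A ++ B) (m + n)
Factorization-++ {past} {B = B} {n} [] g =
  subst (λ p → Factorization p B n) (++-identityʳ past) g
Factorization-++ {past} {B = B} {n} (factor {A = A} {m} w {y} o ¬o f) g =
  subst (λ C → Factorization past C _) (sym (++-assoc (w ∷ʳ y) A B))
    (factor w o ¬o (Factorization-++ f
      (subst (λ p → Factorization p B n) (sym (++-assoc past (w ∷ʳ y) A)) g)))

-- The two bounds on `longestPrevious` meet at `length w`, so each greedy step reads exactly the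
-- next factor of `A`, whatever `c` is. Here `k′` is the fuel left after these `m` steps.
length-factorsFrom : Factorization past A m → ∀ k c → length (A ++ c) ≤ k →
  ∃[ k′ ] length (factorsFrom k past (A ++ c)) ≡ m + length (factorsFrom k′ (past ++ A) c)
length-factorsFrom {past} [] k c _ = k , cong (λ p → length (factorsFrom k p c)) (sym (++-identityʳ past))
length-factorsFrom {past} (factor {A = A} {m} w {y} o ¬o f) k c le
  rewrite ++-assoc (w ∷ʳ y) A c | ++-assoc w [ y ] (A ++ c)
  = go k le
  where
  prefix-length : ∀ w → suc (length (A ++ c)) ≤ length (w ++ y ∷ A ++ c)
  prefix-length w = length-++-≤ʳ (y ∷ A ++ c) {w}
  go : ∀ k → length (w ++ y ∷ A ++ c) ≤ k →
       ∃[ k′ ] length (factorsFrom k past (w ++ y ∷ A ++ c))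
               ≡ suc m + length (factorsFrom k′ (past ++ w ∷ʳ y ++ A) c)
  -- The fuel is positive: the factor `w ∷ʳ y` has at least one letter on top of those of `A ++ c`.
  go k le with k | ≤-trans (prefix-length w) le
  ... | suc k | s≤s le′ with k′ , eq ← length-factorsFrom f k c le′ = k′ , (begin
    length (factorsFrom (suc k) past (w ++ y ∷ A ++ c))
      ≡⟨ cong length (factorsFrom-factor k past w (A ++ c)
           (≤-antisym (longestPrevious-≤ w past ¬o) (longestPrevious-≥ (prefix-++ w _) o))) ⟩
    suc (length (factorsFrom k (past ++ w ∷ʳ y) (A ++ c)))
      ≡⟨ cong suc eq ⟩
    suc m + length (factorsFrom k′ ((past ++ w ∷ʳ y) ++ A) c)
      ≡⟨ cong (λ p → suc m + length (factorsFrom k′ p c)) (++-assoc past (w ∷ʳ y) A) ⟩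
    suc m + length (factorsFrom k′ (past ++ w ∷ʳ y ++ A) c) ∎)
    where open ≡-Reasoning

zn-≥ : ∀ c → Factorization [] A m → m ≤ zn (A ++ c)
zn-≥ c f with _ , eq ← length-factorsFrom f _ c ≤-refl = subst (_ ≤_) (sym eq) (m≤m+n _ _)

zn-≤ : ∀ c → c OccursIn A → Factorization [] A m → zn (A ++ c) ≤ suc m
zn-≤ {m = m} c o f with k′ , eq ← length-factorsFrom f _ c ≤-refl = begin
  _                                        ≡⟨ eq ⟩
  m + length (factorsFrom k′ _ c)          ≤⟨ +-monoʳ-≤ m (factorsFrom-previous k′ o) ⟩
  m + 1                                    ≡⟨ +-comm m 1 ⟩
  suc m                                    ∎
  where open ≤-Reasoning

-- Words of consecutive letters.

interval : ℕ → ℕ → Word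
interval i zero    = []
interval i (suc m) = i ∷ interval (suc i) m

length-interval : ∀ i m → length (interval i m) ≡ m
length-interval i zero    = refl
length-interval i (suc m) = cong suc (length-interval (suc i) m)

interval-∷ʳ : ∀ i m → interval i (suc m) ≡ interval i m ∷ʳ (i + m)
interval-∷ʳ i zero    = cong [_] (sym (+-identityʳ i))
interval-∷ʳ i (suc m) rewrite +-suc i m = cong (i ∷_) (interval-∷ʳ (suc i) m)

interval-prefix : ∀ i → m ≤ n → interval i m IsPrefixOf interval i n
interval-prefix i z≤n       = []
interval-prefix i (s≤s m≤n) = refl ∷ interval-prefix (suc i) m≤n

interval-< : ∀ i m {b} → i + m ≤ b → All (_< b) (interval i m)
interval-< i zero    _  = []
interval-< i (suc m) le rewrite +-suc i m =
  ≤-trans (s≤s (m≤m+n i m)) le ∷ interval-< (suc i) m le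

interval-≥ : ∀ i m {b} → b ≤ i → All (b ≤_) (interval i m)
interval-≥ i zero    _  = []
interval-≥ i (suc m) le = le ∷ interval-≥ (suc i) m (m≤n⇒m≤1+n le)

∈-interval : ∀ i m {x} → i ≤ x → x < i + m → x ∈ interval i m
∈-interval i zero {x} i≤x x<i+0 =
  contradiction (subst (x <_) (+-identityʳ i) x<i+0) (≤⇒≯ i≤x)
∈-interval i (suc m) {x} i≤x x<i+m with i ≟ x
... | yes i≡x = here (sym i≡x)
... | no  i≢x = there (∈-interval (suc i) m (≤∧≢⇒< i≤x i≢x) (subst (x <_) (+-suc i m) x<i+m))

bound-∉ : ∀ {b} → All (_< b) w → b ∉ w
bound-∉ <b b∈ = <-irrefl refl (All.lookup <b b∈)

-- Newness by size: the separators and the letters of the initial interval exceed every letter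
-- before them, so a bound on `past` replaces a search through it.
fresh : ∀ w {y} → All (_< y) past → ¬ ((w ∷ʳ y) OccursIn past)
fresh w <y = last-∉ w (bound-∉ <y)

bounded-∷ʳ : ∀ {y} → All (_< y) w → All (_< suc y) (w ∷ʳ y)
bounded-∷ʳ <y = All.++⁺ (All.map m≤n⇒m≤1+n <y) (≤-refl ∷ [])

interval-Factorization : ∀ i m → All (_< i) past → Factorization past (interval i m) m
interval-Factorization i zero    _  = []
interval-Factorization i (suc m) <i =
  factor [] (here []) (fresh [] <i) (interval-Factorization (suc i) m (bounded-∷ʳ <i))

-- The construction and the factors of its blocks.

-- The letter xⱼ is j - 1, and $ⱼ is C + j for some C ≥ 2k.
blocks : (C i r : ℕ) → Word
blocks C i zero    = []
blocks C i (suc r) = interval 0 (suc i * 2) ∷ʳ (C + suc i) ++ blocks C (suc i) r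

-- The letter `k * 2` is skipped. After the last block, `blocks-split` still carries the claim that
-- `interval 0 (suc (k * 2))` is new; this word contains `k * 2`, which must therefore not be a
-- separator.
base : ℕ → Word
base k = interval 0 (k * 2) ∷ʳ suc (k * 2) ++ blocks (suc (k * 2)) 0 k

module _ (k C : ℕ) (2k≤C : k * 2 ≤ C) where

  block-bounded : ∀ i → i < k → All (_< C + suc i) past →
                  All (_< C + suc (suc i)) (past ++ interval 0 (suc i * 2) ∷ʳ (C + suc i))
  block-bounded {past} i i<k <s = subst
    (λ b → All (_< b) (past ++ interval 0 (suc i * 2) ∷ʳ (C + suc i))) (sym (+-suc C (suc i)))
    (All.++⁺ (All.map m≤n⇒m≤1+n <s)
       (bounded-∷ʳ (interval-< 0 (suc i * 2)
          (≤-trans (*-monoˡ-≤ 2 i<k) (≤-trans 2k≤C (m≤m+n C (suc i)))))))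

  -- The initial interval stays in the past, so each shorter interval occurs as its prefix, and the
  -- separator exceeds every earlier letter. The counter `i` is the number of blocks already read.
  blocks-Factorization : ∀ i r → r + i ≡ k → interval 0 (k * 2) OccursIn past →
                         All (_< C + suc i) past → Factorization past (blocks C i r) r
  blocks-Factorization i zero    _  _ _  = []
  blocks-Factorization i (suc r) eq o <s =
    factor (interval 0 (suc i * 2))
      (Infix.Prefix-Infix-trans trans (interval-prefix 0 (*-monoˡ-≤ 2 i<k)) o)
      (fresh (interval 0 (suc i * 2)) <s)
      (blocks-Factorization (suc i) r (trans (+-suc r i) eq) (o ⁱ++ _) (block-bounded i i<k <s))
    where
    i<k : i < k
    i<k = subst (i <_) eq (m<n+m i z<s)

  -- The first factor ends with the letter `i * 2`, the first one at which the known prefix fails.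
  -- The next letter `suc (i * 2)` is known on its own, and the separator then completes the second
  -- factor. For `i = 0` the first factor is the deleted letter `0` alone.
  block-split : ∀ i → interval 0 (i * 2) OccursIn past → ¬ (interval 0 (suc (i * 2)) OccursIn past) →
                suc (i * 2) ∈ past → i < k → All (_< C + suc i) past →
                Factorization past (interval 0 (suc i * 2) ∷ʳ (C + suc i)) 2
  block-split {past} i o ¬o x∈ i<k <s = subst (λ A → Factorization past A 2) (sym split)
    (factor (interval 0 (i * 2)) o
      (subst (λ v → ¬ (v OccursIn past)) (interval-∷ʳ 0 (i * 2)) ¬o)
      (single [ suc (i * 2) ] (occurs-singleton (∈-++⁺ˡ x∈))
        (fresh [ suc (i * 2) ] (All.++⁺ <s (subst (All (_< C + suc i)) (interval-∷ʳ 0 (i * 2))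
          (interval-< 0 (suc (i * 2)) (≤-trans (n≤1+n _)
            (≤-trans (*-monoˡ-≤ 2 i<k) (≤-trans 2k≤C (m≤m+n C (suc i)))))))))))
    where
    split : interval 0 (suc i * 2) ∷ʳ (C + suc i)
            ≡ interval 0 (i * 2) ∷ʳ (i * 2) ++ [ suc (i * 2) ] ∷ʳ (C + suc i)
    split = trans (cong (_∷ʳ (C + suc i)) (trans (interval-∷ʳ 0 (suc (i * 2)))
                    (cong (_∷ʳ suc (i * 2)) (interval-∷ʳ 0 (i * 2)))))
                  (++-assoc (interval 0 (i * 2) ∷ʳ (i * 2)) _ _)

  -- The separator s at the end of the past keeps an occurrence of x₁⋯x₂ᵢ₊₁ from
  -- straddling q and the next block.
  blocks-split : ∀ i r q s → r + i ≡ k → k * 2 < s →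
                 interval 0 (i * 2) OccursIn (q ∷ʳ s) →
                 ¬ (interval 0 (suc (i * 2)) OccursIn q) →
                 (∀ {x} → 0 < x → x < k * 2 → x ∈ q ∷ʳ s) →
                 All (_< C + suc i) (q ∷ʳ s) →
                 Factorization (q ∷ʳ s) (blocks C i r) (r * 2)
  blocks-split i zero    q s _  _    _ _  _  _  = []
  blocks-split i (suc r) q s eq 2k<s o ¬o x∈ <s =
    Factorization-++
      (block-split i o ¬o-past (x∈ z<s 1+2i<2k) i<k <s)
      (subst (λ p → Factorization p (blocks C (suc i) r) (r * 2)) (++-assoc (q ∷ʳ s) I [ C + suc i ])
        -- The interval of this block joins `q`, and its separator takes over the role of `s`.
        (blocks-split (suc i) r (q ∷ʳ s ++ I) (C + suc i) (trans (+-suc r i) eq)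
          (≤-<-trans 2k≤C (m<m+n C z<s))
          (((q ∷ʳ s) ++ⁱ here prefix-refl) ⁱ++ [ C + suc i ]) ¬o′
          (λ 0<x x<2k → ∈-++⁺ˡ (∈-++⁺ˡ (x∈ 0<x x<2k)))
          (subst (All (_< C + suc (suc i))) (sym (++-assoc (q ∷ʳ s) I [ C + suc i ]))
            (block-bounded i i<k <s))))
    where
    I : Word
    I = interval 0 (suc i * 2)
    i<k : i < k
    i<k = subst (i <_) eq (m<n+m i z<s)
    1+2i<2k : suc (i * 2) < k * 2
    1+2i<2k = *-monoˡ-≤ 2 i<k
    s∉ : ∀ {m} → m ≤ suc (k * 2) → s ∉ interval 0 m
    s∉ {m} m≤ = bound-∉ (interval-< 0 m (≤-trans m≤ 2k<s))
    ¬o-past : ¬ (interval 0 (suc (i * 2)) OccursIn (q ∷ʳ s))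
    ¬o-past o with occurs-separator q (s∉ (m≤n⇒m≤1+n (<⇒≤ 1+2i<2k))) o
    ... | inj₁ o-q = ¬o o-q
    ... | inj₂ (here ())
    -- Since `s` cannot be crossed, an occurrence lies in `q`, where its prefix is already excluded
    -- by `¬o`, or in `I`, which is one letter too short.
    ¬o′ : ¬ (interval 0 (suc (suc i * 2)) OccursIn (q ∷ʳ s ++ I))
    ¬o′ o rewrite ++-assoc q [ s ] I
      with occurs-separator q (s∉ (s≤s 1+2i<2k)) o
    ... | inj₁ o-q = ¬o (Infix.Prefix-Infix-trans trans (interval-prefix 0 (m≤n+m (suc (i * 2)) 2)) o-q)
    ... | inj₂ o-I with le ← Infix.length-mono o-I
      rewrite length-interval 0 (suc (suc i * 2)) | length-interval 0 (suc i * 2) = <-irrefl refl le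

-- Lengths of the blocks and of the base word.

-- Block `j` has `2j + 1` letters, so `i * (2 + i)` is the total length of the first `i` blocks;
-- adding it on the left avoids a subtraction.
length-blocks : ∀ C i r → length (blocks C i r) + i * (2 + i) ≡ (i + r) * (2 + (i + r))
length-blocks C i zero    = cong (λ i → i * (2 + i)) (sym (+-identityʳ i))
length-blocks C i (suc r) = begin
  length (I ∷ʳ (C + suc i) ++ bs) + i * (2 + i)
    ≡⟨ cong (_+ i * (2 + i)) (trans (length-++ (I ∷ʳ (C + suc i)))
         (cong (_+ length bs) (trans (length-++ I) (cong (_+ 1) (length-interval 0 (suc i * 2)))))) ⟩
  suc i * 2 + 1 + length bs + i * (2 + i)
    ≡⟨ regroup i (length bs) ⟩
  length bs + suc i * (2 + suc i)
    ≡⟨ length-blocks C (suc i) r ⟩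
  (suc i + r) * (2 + (suc i + r))
    ≡⟨ cong (λ j → j * (2 + j)) (sym (+-suc i r)) ⟩
  (i + suc r) * (2 + (i + suc r)) ∎
  where
  open ≡-Reasoning
  I bs : Word
  I  = interval 0 (suc i * 2)
  bs = blocks C (suc i) r
  regroup : ∀ i l → suc i * 2 + 1 + l + i * (2 + i) ≡ l + suc i * (2 + suc i)
  regroup = solve-∀

baseLength : ℕ → ℕ
baseLength k = k * 2 + 1 + k * (2 + k)

length-base : ∀ k → length (base k) ≡ baseLength k
length-base k = begin
  length (I ∷ʳ C ++ blocks C 0 k)
    ≡⟨ length-++ (I ∷ʳ C) ⟩
  length (I ∷ʳ C) + length (blocks C 0 k)
    ≡⟨ cong₂ _+_ (trans (length-++ I) (cong (_+ 1) (length-interval 0 (k * 2))))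
                 (trans (sym (+-identityʳ _)) (length-blocks C 0 k)) ⟩
  baseLength k ∎
  where
  open ≡-Reasoning
  I : Word
  I = interval 0 (k * 2)
  C : ℕ
  C = suc (k * 2)

-- The counts before and after the deletion.

base-Factorization : ∀ k → Factorization [] (base k) (k * 2 + 1 + k)
base-Factorization k =
  Factorization-++
    (Factorization-++ (interval-Factorization 0 (k * 2) [])
      (single [] (here []) (fresh [] (interval-< 0 (k * 2) (n≤1+n _)))))
    (blocks-Factorization k C (n≤1+n _) 0 k (+-identityʳ k)
      (here (prefix-++ (interval 0 (k * 2)) [ C ]))
      (subst (λ b → All (_< b) (interval 0 (k * 2) ∷ʳ C)) (+-comm 1 C)
        (bounded-∷ʳ (interval-< 0 (k * 2) (n≤1+n _)))))
  where
  C : ℕ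
  C = suc (k * 2)

base-drop-Factorization : ∀ k → Factorization [] (drop 1 (base (suc k))) (suc k * 4)
base-drop-Factorization k = subst (Factorization [] (drop 1 (base (suc k)))) (count k)
  (Factorization-++
    (Factorization-++ (interval-Factorization 1 (suc (k * 2)) [])
      (single [] (here []) (fresh [] <C)))
    (blocks-split (suc k) C (n≤1+n _) 0 (suc k) I C (+-identityʳ _) ≤-refl
      -- At `i = 0` the known prefix is empty and the prefix to be new is the letter `0`, absent
      -- because all letters of `I` are at least 1.
      (here [])
      (λ o → <-irrefl refl (All.lookup (interval-≥ 1 (suc (k * 2)) ≤-refl) (occurs-∈ o (here refl))))
      (λ 0<x x<2k → ∈-++⁺ˡ (∈-interval 1 (suc (k * 2)) 0<x x<2k))
      (subst (λ b → All (_< b) (I ∷ʳ C)) (+-comm 1 C) (bounded-∷ʳ <C))))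
  where
  C : ℕ
  C = suc (suc k * 2)
  I : Word
  I = interval 1 (suc (k * 2))
  <C : All (_< C) I
  <C = interval-< 1 (suc (k * 2)) (n≤1+n _)
  count : ∀ k → suc (k * 2) + 1 + suc k * 2 ≡ suc k * 4
  count = solve-∀

-- Padding to every length.

padded : ℕ → ℕ → Word
padded k n = base k ++ take (n ∸ baseLength k) (base k)

length-padded : ∀ k n → baseLength k ≤ n → n ≤ baseLength k + baseLength k → length (padded k n) ≡ n
length-padded k n l≤n n≤2l = begin
  length (base k ++ take (n ∸ l) (base k))  ≡⟨ length-++ (base k) ⟩
  length (base k) + length (take (n ∸ l) (base k))
    ≡⟨ cong₂ _+_ (length-base k) (trans (length-take (n ∸ l) (base k))
                                        (cong ((n ∸ l) ⊓_) (length-base k))) ⟩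
  l + (n ∸ l) ⊓ l   ≡⟨ cong (λ r → l + r) (m≤n⇒m⊓n≡m (m≤n+o⇒m∸n≤o n l n≤2l)) ⟩
  l + (n ∸ l)       ≡⟨ m+[n∸m]≡n l≤n ⟩
  n                 ∎
  where
  open ≡-Reasoning
  l : ℕ
  l = baseLength k

zn-padded : ∀ k n → zn (padded k n) ≤ k * 3 + 2
zn-padded k n = ≤-trans
  (zn-≤ (take (n ∸ baseLength k) (base k)) (here (take-prefix (n ∸ baseLength k) (base k)))
        (base-Factorization k))
  (≤-reflexive (count k))
  where
  take-prefix : ∀ r (w : Word) → take r w IsPrefixOf w
  take-prefix r w = subst (take r w IsPrefixOf_) (take++drop≡id r w) (prefix-++ (take r w) (drop r w))
  count : ∀ k → suc (k * 2 + 1 + k) ≡ k * 3 + 2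
  count = solve-∀

-- Deleting the first letter leaves the pad in place, and the `suc k * 4` factors before it are
-- complete, so they survive.
zn-drop-padded : ∀ k n → suc k * 4 ≤ zn (padded (suc k) n [ 2 ‥])
zn-drop-padded k n = zn-≥ (take (n ∸ baseLength (suc k)) (base (suc k))) (base-drop-Factorization k)

-- Raising the length by one either stays below the next base length or hits it, and then `k` moves
-- up. The start is `baseLength 0 = 1`.
between : ∀ n → ∃[ k ] (baseLength k ≤ suc n × suc n < baseLength (suc k))
between zero = 0 , ≤-refl , s≤s (s≤s z≤n)
between (suc n) with k , l≤n , n<l ← between n with m≤n⇒m<n∨m≡n n<l
... | inj₁ 2+n<l = k , m≤n⇒m≤1+n l≤n , 2+n<l
... | inj₂ 2+n≡l = suc k , ≤-reflexive (sym 2+n≡l)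
                 , subst (_< baseLength (2 + k)) (sym 2+n≡l) (increasing (suc k))
  where
  step : ∀ k → suc k * 2 + 1 + suc k * (2 + suc k) ≡ suc (k * 2 + 1 + k * (2 + k)) + (4 + k * 2)
  step = solve-∀
  increasing : ∀ k → baseLength k < baseLength (suc k)
  increasing k = subst (baseLength k <_) (sym (step k)) (m≤m+n _ _)

baseLength-mono : m ≤ n → baseLength m ≤ baseLength n
baseLength-mono m≤n =
  +-mono-≤ (+-monoˡ-≤ 1 (*-monoˡ-≤ 2 m≤n)) (*-mono-≤ m≤n (+-monoʳ-≤ 2 m≤n))

-- This is why a prefix of one base word suffices as padding up to the next base length. The
-- difference is `k * 4 + k * k`, with equality at `k = 0`.
baseLength-double : ∀ k → baseLength (2 + k) ≤ suc (baseLength (suc k) + baseLength (suc k))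
baseLength-double k = subst (baseLength (2 + k) ≤_) (sym (eq k)) (m≤m+n _ _)
  where
  eq : ∀ k → suc ((suc k * 2 + 1 + suc k * (2 + suc k)) + (suc k * 2 + 1 + suc k * (2 + suc k)))
             ≡ (2 + k) * 2 + 1 + (2 + k) * (2 + (2 + k)) + (k * 4 + k * k)
  eq = solve-∀

-- The comparison with 4/3.

-- Replacing `suc p` by 1 and inserting the bounds on `a` and `b` leaves `2 + d * 8 ≤ k * 9`, which
-- `suc d ≤ k` gives. The form is that of 4/3 ≤ a/b + ε for ε = (p + 1)/(d + 1), with denominators
-- cleared.
4/3-cross : ∀ k a b p d → suc d ≤ k → k * 4 ≤ a → b ≤ k * 3 + 2 →
            4 * (b * suc d) ≤ (a * suc d + suc p * b) * 3
4/3-cross k a b p d d<k 4k≤a b≤ = begin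
  -- Three copies of `b` are set aside, to be paid for by ε.
  4 * (b * suc d)                       ≡⟨ e₁ b d ⟩
  b * (1 + d * 4) + b * 3               ≤⟨ +-monoˡ-≤ (b * 3) (*-monoˡ-≤ (1 + d * 4) b≤) ⟩
  (k * 3 + 2) * (1 + d * 4) + b * 3     ≡⟨ cong (λ x → x + b * 3) (e₂ k d) ⟩
  k * 3 + (2 + d * 8) + k * d * 12 + b * 3
    ≤⟨ +-monoˡ-≤ (b * 3) (+-monoˡ-≤ (k * d * 12) (+-monoʳ-≤ (k * 3) 2+8d≤9k)) ⟩
  k * 3 + k * 9 + k * d * 12 + b * 3    ≡⟨ e₃ k d b ⟩
  (k * 4 * suc d + 1 * b) * 3
    ≤⟨ *-monoˡ-≤ 3 (+-mono-≤ (*-monoˡ-≤ (suc d) 4k≤a) (*-monoˡ-≤ b {1} {suc p} (s≤s z≤n))) ⟩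
  (a * suc d + suc p * b) * 3           ∎
  where
  open ≤-Reasoning
  e₁ : ∀ b d → 4 * (b * suc d) ≡ b * (1 + d * 4) + b * 3
  e₁ = solve-∀
  e₂ : ∀ k d → (k * 3 + 2) * (1 + d * 4) ≡ k * 3 + (2 + d * 8) + k * d * 12
  e₂ = solve-∀
  e₃ : ∀ k d b → k * 3 + k * 9 + k * d * 12 + b * 3 ≡ (k * 4 * suc d + 1 * b) * 3
  e₃ = solve-∀
  e₄ : ∀ d → suc d * 9 ≡ 2 + d * 8 + (7 + d)
  e₄ = solve-∀
  2+8d≤9k : 2 + d * 8 ≤ k * 9
  2+8d≤9k = ≤-trans (≤-trans (m≤m+n _ (7 + d)) (≤-reflexive (sym (e₄ d)))) (*-monoˡ-≤ 9 d<k)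

-- A positive rational is at least the reciprocal of its denominator, so `k` only has to reach the
-- denominator of `ε`.
4/3-bound : ∀ ε → 0ℚ ℚ.< ε → ∀ k a b .{{_ : NonZero b}} → ℚ.↧ₙ ε ≤ k → k * 4 ≤ a → b ≤ k * 3 + 2 →
            (+ 4 / 3) ℚ.- ε ℚ.≤ + a / b
4/3-bound (mkℚ (+ 0) _ _) (*<* (ℤ.+<+ ()))
4/3-bound (mkℚ ℤ.-[1+ _ ] _ _) (*<* ())
4/3-bound ε@(mkℚ +[1+ p ] d _) _ k a b@(suc b′) d<k 4k≤a b≤ = begin
  (+ 4 / 3) ℚ.- ε              ≤⟨ ℚ.+-monoˡ-≤ (ℚ.- ε) sum-bound ⟩
  (+ a / b ℚ.+ ε) ℚ.- ε        ≡⟨ ℚ.+-assoc (+ a / b) ε (ℚ.- ε) ⟩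
  + a / b ℚ.+ (ε ℚ.- ε)        ≡⟨ cong (+ a / b ℚ.+_) (ℚ.+-inverseʳ ε) ⟩
  + a / b ℚ.+ 0ℚ               ≡⟨ ℚ.+-identityʳ (+ a / b) ⟩
  + a / b                      ∎
  where
  open ℚ.≤-Reasoning
  -- Unnormalised fractions keep `a` and `b` as they are, which turns the comparison into
  -- `4/3-cross`.
  sumᵘ : ℚᵘ.mkℚᵘ (+ 4) 2 ℚᵘ.≤ ℚᵘ.mkℚᵘ (+ a) b′ ℚᵘ.+ ℚᵘ.mkℚᵘ +[1+ p ] d
  sumᵘ = ℚᵘ.*≤* (subst (+ 4 ℤ.* + (b * suc d) ℤ.≤_)
    (trans (ℤ.pos-* (a * suc d + suc p * b) 3)
      (cong (ℤ._* + 3) (cong₂ ℤ._+_ (ℤ.pos-* a (suc d)) (ℤ.pos-* (suc p) b))))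
    (+≤+ (4/3-cross k a b p d d<k 4k≤a b≤)))
  sum-bound : + 4 / 3 ℚ.≤ + a / b ℚ.+ ε
  sum-bound = ℚ.toℚᵘ-cancel-≤ (ℚᵘ.≤-respʳ-≃
    (ℚᵘ.≃-sym (ℚᵘ.≃-trans (ℚ.toℚᵘ-homo-+ (+ a / b) ε)
      (ℚᵘ.+-congˡ (ℚ.toℚᵘ ε) (ℚ.toℚᵘ-fromℚᵘ (ℚᵘ.mkℚᵘ (+ a) b′))))) sumᵘ)

lemma2 : (+ 4 / 3) ≤liminf ζ
-- From this length on, the `k` found by `between` is at least the denominator of `ε`.
lemma2 ε 0<ε = baseLength (ℚ.↧ₙ ε) , eventually
  where
  eventually : ∀ n → baseLength (ℚ.↧ₙ ε) ≤ n → (+ 4 / 3) ℚ.- ε ℚ.≤ ζ n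
  eventually zero    ()
  eventually (suc n) N≤n with between n
  -- The denominator of `ε` is at least 1, so the length is at least `baseLength 1`.
  ... | zero , _ , n<l = contradiction (≤-trans (baseLength-mono {1} {ℚ.↧ₙ ε} (s≤s z≤n)) N≤n) (<⇒≱ n<l)
  ... | suc k , l≤n , n<l = ℚ.≤-trans
    (4/3-bound ε 0<ε (suc k) _ _ (≮⇒≥ λ k<d → <⇒≱ n<l (≤-trans (baseLength-mono k<d) N≤n))
       (zn-drop-padded k (suc n)) (zn-padded (suc k) (suc n)))
    (proj₂ (ζ-isMaximum (suc n) 2≤n) _
      (padded (suc k) (suc n) , 2
      , length-padded (suc k) (suc n) l≤n (s≤s⁻¹ (≤-trans n<l (baseLength-double k)))
      , ≤-refl , 2≤n , refl))
    where
    2≤n : 2 ≤ suc n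
    2≤n = ≤-trans (≤-trans (s≤s (s≤s z≤n)) (baseLength-mono {1} {suc k} (s≤s z≤n))) l≤n
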